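{- Let $n\ge 3$. For every $\xi\in\mathcal{C}(\mathcal{G}_n)$, the number $lg(n;\xi)$ of labelled graphs $G$ of order $n$ with $|\Gamma(G)|=\xi$ satisfies $$lg(n;\xi)=|\mathcal{L}_\xi(\mathcal{G}_n)|.$$
   Context: Let $V=\{1,\dots,n\}$ and let $\binom{V}{2}$ be the set of 2-element subsets of $V$; write $ij$ for $\{i,j\}$ with $i<j$. A labelled graph of order $n$ is a pair $G=(V,E)$ with $E\subseteq\binom{V}{2}$; $\mathcal{G}_n$ is the set of all of them. Let $A$ be the symmetric group on $V$. For $\alpha\in A$, $\alpha G$ is the graph on $V$ with edge-set $\{\{\alpha i,\alpha j\}: ij\in E\}$; $\Gamma(G)=\{\alpha\in A:\alpha G=G\}$ is the automorphism group of $G$. Let $\alpha'$ be the permutation of $\binom{V}{2}$ given by $\alpha'\{i,j\}=\{\alpha i,\alpha j\}$, and let $Z(\alpha')$ be the set of all cycles (including cycles of length 1) in the disjoint cycle decomposition of $\alpha'$. Let $\lambda=\binom{n}{2}$, and for $ij\in\binom{V}{2}$ ($i<j$) let $p_{ij}=\frac{(2n-i)(i-1)}{2}+(j-i)$ and $w(ij)=2^{\lambda-p_{ij}}$. For a cycle $z$ let $W(z)=\sum_{ij\in z}w(ij)$, and define the polynomials $$F_\alpha^{(n)}(x)=\prod_{z\in Z(\alpha')}\bigl(1+x^{W(z)}\bigr)\ (\alpha\in A),\qquad F^{(n)}(x)=\sum_{\alpha\in A}F_\alpha^{(n)}(x).$$ Let $c_L$ be the coefficient of $x^L$ in $F^{(n)}(x)$.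 Put $\mathcal{C}(\mathcal{G}_n)=\{c_L : L\ge 0,\ c_L\neq 0\}$ (the set of coefficients of terms occurring in $F^{(n)}(x)$), and for a positive integer $\xi$ put $\mathcal{L}_\xi(\mathcal{G}_n)=\{L : c_L=\xi\}$. -}

module Defs where

open import Data.Bool.Base using (Bool; _∧_)
open import Data.Bool.ListAction using (any)
open import Data.Empty using (⊥-elim-irr)
open import Data.Fin.Base using (Fin; toℕ; _<_)
import Data.Fin.Base as Fin
import Data.Fin.Properties as Fin
import Data.Fin.Permutation as Perm
open import Data.Fin.Permutation using (Permutation′; _⟨$⟩ʳ_; insert)
open import Data.List.Base
  using (List; []; _∷_; _++_; map; concatMap; mapMaybe; foldr; length;
         replicate; iterate; takeWhile; deduplicate; allFin)
import Data.List.Membership.DecPropositional as DecMembership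
open import Data.Maybe.Base using (Maybe; just; nothing)
open import Data.Nat.Base using (ℕ; zero; suc; _+_; _*_; _∸_; _^_; _/_)
open import Data.Nat.Combinatorics using (_C_)
open import Data.Nat.ListAction using (sum)
open import Data.Product.Base using (∃-syntax; _×_; proj₁)
open import Function.Bundles using (Inverse; Injection)
open import Function.Properties.Inverse using (↔⇒↣)
open import Level using (Level)
open import Relation.Binary.Bundles using (Setoid)
import Relation.Binary.Construct.On as On
open import Relation.Binary.Definitions using (DecidableEquality; tri<; tri≈; tri>)
open import Relation.Binary.PropositionalEquality
  using (_≡_; _≢_; refl; sym; trans; setoid; _→-setoid_)
open import Relation.Nullary using (yes; no; does; ¬?)

private
  variable
    a ℓ p : Level

infix 4 _HasCardinality_

_HasCardinality_ : Setoid a ℓ → ℕ → Set _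
S HasCardinality k = Inverse S (setoid (Fin k))

-- The subset { x ∈ S | P x }; the proof of P x is irrelevant to equality.
Subset : (S : Setoid a ℓ) → (Setoid.Carrier S → Set p) → Setoid _ _
Subset S P = On.setoid S (proj₁ {B = P})

-- V = {1,…,n} is represented by Fin n, with i : Fin n standing for the
-- vertex suc (toℕ i).  The set {i , j} with i < j is pair i j.
record Pair (n : ℕ) : Set where
  constructor pair
  field
    lo hi  : Fin n
    .lo<hi : lo < hi

open Pair public

infix 4 _≟_

_≟_ : ∀ {n} → DecidableEquality (Pair n)
pair i j _ ≟ pair k l _ with i Fin.≟ k | j Fin.≟ l
... | yes refl | yes refl = yes refl
... | no  i≢k  | _        = no λ { refl → i≢k refl }
... | yes _    | no j≢l   = no λ { refl → j≢l refl }

⁅_,_⁆ : ∀ {n} (i j : Fin n) → .(i ≢ j) → Pair n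
⁅ i , j ⁆ i≢j with Fin.<-cmp i j
... | tri< i<j _   _   = pair i j i<j
... | tri≈ _   i≡j _   = ⊥-elim-irr (i≢j i≡j)
... | tri> _   _   j<i = pair j i j<i

pair? : ∀ {n} → Fin n → Fin n → Maybe (Pair n)
pair? i j with i Fin.<? j
... | yes i<j = just (pair i j i<j)
... | no  _   = nothing

pairs : ∀ n → List (Pair n)
pairs n = concatMap (λ i → mapMaybe (pair? i) (allFin n)) (allFin n)

Sym : ℕ → Setoid _ _
Sym n = record
  { Carrier       = Permutation′ n
  ; _≈_           = Perm._≈_
  ; isEquivalence = record
    { refl  = λ _ → refl
    ; sym   = λ α≈β i → sym (α≈β i)
    ; trans = λ α≈β β≈γ i → trans (α≈β i) (β≈γ i)
    }
  }

-- Every permutation exactly once up to Perm._≈_: a permutation of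
-- Fin (suc n) is determined by the image j of zero and by what remains
-- after removing zero and j.
permutations : ∀ n → List (Permutation′ n)
permutations zero    = Perm.id ∷ []
permutations (suc n) =
  concatMap (λ α → map (λ j → insert Fin.zero j α) (allFin (suc n))) (permutations n)

infix 25 _′

_′ : ∀ {n} → Permutation′ n → Pair n → Pair n
(α ′) (pair i j i<j) =
  ⁅ α ⟨$⟩ʳ i , α ⟨$⟩ʳ j ⁆
    (λ αi≡αj → Fin.<⇒≢ i<j (Injection.injective (↔⇒↣ α) αi≡αj))

-- A graph on V is the characteristic function of its edge set.
Graph : ℕ → Set
Graph n = Pair n → Bool

𝓖 : ℕ → Setoid _ _
𝓖 n = Pair n →-setoid Bool

-- The edge set of α · G is the image of that of G under α ′.
infixr 7 _·_

_·_ : ∀ {n} → Permutation′ n → Graph n → Graph n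
_·_ {n} α G e = any (λ f → G f ∧ does ((α ′) f ≟ e)) (pairs n)

Γ : ∀ {n} → Graph n → Setoid _ _
Γ {n} G = Subset (Sym n) (λ α → ∀ e → (α · G) e ≡ G e)

-- The cycle e, α′ e, (α′)² e, … stopping just before the first return
-- to e, which takes at most length (pairs n) steps.
cycle : ∀ {n} → Permutation′ n → Pair n → List (Pair n)
cycle {n} α e =
  e ∷ takeWhile (λ f → ¬? (f ≟ e)) (iterate (α ′) ((α ′) e) (length (pairs n)))

-- One representative is kept from each cycle.
Z : ∀ {n} → Permutation′ n → List (List (Pair n))
Z {n} α = map (cycle α) (deduplicate (λ e f → f ∈? cycle α e) (pairs n))
  where open DecMembership _≟_ using (_∈?_)

-- Coefficient lists, constant term first; trailing zeros are allowed.
Poly : Set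
Poly = List ℕ

coeff : Poly → ℕ → ℕ
coeff []      _       = 0
coeff (a ∷ _) zero    = a
coeff (_ ∷ p) (suc k) = coeff p k

infixl 6 _⊕_
infixl 7 _⊗_

_⊕_ : Poly → Poly → Poly
[]      ⊕ q       = q
p@(_ ∷ _) ⊕ []    = p
(a ∷ p) ⊕ (b ∷ q) = a + b ∷ p ⊕ q

_⊗_ : Poly → Poly → Poly
[]      ⊗ q = []
(a ∷ p) ⊗ q = map (a *_) q ⊕ (0 ∷ p ⊗ q)

x^_ : ℕ → Poly
x^ k = replicate k 0 ++ 1 ∷ []

-- The vertices are i = suc (toℕ lo) and j = suc (toℕ hi).  Every
-- truncated subtraction and the halving below are exact.
position : ∀ {n} → Pair n → ℕ
position {n} e = ((2 * n ∸ i) * (i ∸ 1)) / 2 + (j ∸ i)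
  where
  i = suc (toℕ (lo e))
  j = suc (toℕ (hi e))

w : ∀ {n} → Pair n → ℕ
w {n} e = 2 ^ (n C 2 ∸ position e)

W : ∀ {n} → List (Pair n) → ℕ
W z = sum (map w z)

Fₐ : ∀ {n} → Permutation′ n → Poly
Fₐ α = foldr _⊗_ (x^ 0) (map (λ z → x^ 0 ⊕ x^ (W z)) (Z α))

F : ℕ → Poly
F n = foldr _⊕_ [] (map Fₐ (permutations n))

c : ℕ → ℕ → ℕ
c n L = coeff (F n) L

𝓒 : ℕ → ℕ → Set
𝓒 n ξ = ∃[ L ] (c n L ≢ 0 × c n L ≡ ξ)

𝓛 : ℕ → ℕ → Setoid _ _
𝓛 n ξ = Subset (setoid ℕ) (λ L → c n L ≡ ξ)

GraphsWithAut : ℕ → ℕ → Setoid _ _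
GraphsWithAut n ξ = Subset (𝓖 n) (λ G → Γ G HasCardinality ξ)

{-# OPTIONS --safe #-}

-- Encode a graph G by the sum label G of the weights of its edges.  The
-- weights are distinct powers of two, so the label determines G.  Expanding
-- the product Fₐ α, the exponents that occur are the weights of the unions of
-- cycles of α ′, that is, the labels of the graphs fixed by α, each exactly
-- once.  Hence the coefficient of x^(label G) in F is the number of α fixing
-- G, and all other coefficients vanish: for ξ ≢ 0 the label is a bijection
-- from the graphs with |Γ(G)| = ξ onto 𝓛 n ξ, which is finite because F is a
-- polynomial.

module Submission where

open import Defs
open import Algebra.Properties.CommutativeSemigroup using (interchange)
open import Data.Bool.Base using (true; false; T)
import Data.Bool.Properties as Bool
open import Data.Empty using (⊥-elim-irr)
open import Data.Fin.Base using (Fin; zero; suc; toℕ)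
import Data.Fin.Base as Fin
import Data.Fin.Properties as Fin
open import Data.Fin.Permutation
  using (Permutation′; _⟨$⟩ʳ_; insert; remove; insert-punchIn; insert-remove; ↔⇒≡)
import Data.Fin.Permutation as Perm
open import Data.List.Base as List
  using (List; []; _∷_; _++_; map; mapMaybe; concat; concatMap; foldr; length; lookup; filter;
         filterᵇ; takeWhile; deduplicate; allFin; upTo)
open import Data.List.Properties
  using (filter-++; filter-none; filter-accept; filter-reject; filter-≐; length-++;
         map-++; map-∘; map-id; map-cong)
open import Data.List.Membership.Propositional using (_∈_; _∉_; find; lose)
open import Data.List.Membership.Propositional.Properties
  using (∈-map⁺; ∈-map⁻; ∈-++⁺ˡ; ∈-++⁺ʳ; ∈-++⁻; ∈-concatMap⁺; ∈-filter⁺; ∈-filter⁻;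
         ∈-allFin; ∈-lookup; ∈-upTo⁺)
import Data.List.Membership.DecPropositional as DecMembership
import Data.List.Membership.Propositional.Properties.WithK as WithK
import Data.List.Membership.Setoid as SetoidMembership
import Data.List.Membership.Setoid.Properties as SetoidMembershipProperties
open import Data.List.Relation.Binary.BagAndSetEquality using (∼bag⇒↭)
open import Data.List.Relation.Binary.Disjoint.Propositional using (Disjoint)
import Data.List.Relation.Binary.Disjoint.Propositional.Properties as Disjoint
import Data.List.Relation.Binary.Permutation.Propositional.Properties as ↭
open import Data.List.Relation.Unary.All as All using (All; []; _∷_)
import Data.List.Relation.Unary.All.Properties as All
open import Data.List.Relation.Unary.AllPairs as AllPairs using (AllPairs; []; _∷_)
import Data.List.Relation.Unary.AllPairs.Properties as AllPairs
open import Data.List.Relation.Unary.Any as Any using (Any; here; there)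
import Data.List.Relation.Unary.Any.Properties as Any
import Data.List.Relation.Unary.Unique.Setoid as SetoidUnique
open import Data.List.Relation.Unary.Unique.Propositional using (Unique)
import Data.List.Relation.Unary.Unique.Propositional.Properties as Unique
open import Data.Maybe.Base using (Maybe; just; nothing)
import Data.Maybe.Relation.Unary.Any as Maybe
open import Data.Nat.Base
open import Data.Nat.Combinatorics using (_C_; nCk+nC[k+1]≡[n+1]C[k+1]; nC1≡n)
open import Data.Nat.DivMod using (m*n/n≡m)
open import Data.Nat.GeneralisedArithmetic using (iterate)
open import Data.Nat.ListAction using (sum)
open import Data.Nat.ListAction.Properties using (sum-++; sum-↭)
open import Data.Nat.Properties as ℕ hiding (_≟_)
open import Data.Nat.Tactic.RingSolver using (solve-∀)
open import Data.Product.Base using (∃-syntax; _×_; _,_; proj₁; proj₂)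
open import Data.Sum.Base using (_⊎_; inj₁; inj₂)
open import Function.Base using (_∘_; case_of_)
open import Function.Bundles using (_⇔_; mk⇔; Equivalence; Inverse; Injection)
import Function.Construct.Composition as Composition
import Function.Construct.Symmetry as Symmetry
open import Function.Properties.Inverse using (↔⇒↣)
open import Level using (Level)
open import Relation.Binary.Bundles using (Setoid)
open import Relation.Binary.Core using (Rel)
open import Relation.Binary.Definitions using (DecidableEquality; tri<; tri≈; tri>)
open import Relation.Binary.PropositionalEquality
  using (_≡_; _≢_; refl; sym; trans; cong; cong₂; subst; subst₂; setoid; module ≡-Reasoning)
open import Relation.Nullary
open import Relation.Nullary.Decidable using (map′; decidable-stable)
open import Relation.Unary using (Pred)

-- A product of binomials records only the weights of unions, so two choices of cycles with equal
-- weight would merge into a coefficient 2. Binary expansion excludes this: along the lexicographic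
-- list of pairs the exponents strictly decrease, so every weight exceeds the sum of all later ones
-- and equal weights force equal edge sets. As the cycles are disjoint and nonempty, equal edge sets
-- force equal choices. A second gap lies between the two descriptions of `α ′`: `α · G` is defined
-- through images of edges, while `Z α` comes from an iteration of bounded length. The pigeonhole
-- principle shows that the bound suffices and that the injective map `α ′` is surjective, which
-- makes fixing `G` the same as `G` being constant on cycles.

private
  variable
    a b ℓ p r s : Level
    A : Set a
    B : Set b
    n : ℕ

-- Counting by enumeration

module _ (S : Setoid a ℓ) where
  open Setoid S renaming (sym to ≈-sym; trans to ≈-trans; refl to ≈-refl)
  open SetoidMembership S using () renaming (_∈_ to _∈ₛ_)

  lookup-injective : ∀ {xs} → SetoidUnique.Unique S xs →
                     ∀ i j → lookup xs i ≈ lookup xs j → i ≡ j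
  lookup-injective (_   ∷ _)   zero    zero    _  = refl
  lookup-injective (x∉ ∷ _)    zero    (suc j) eq = contradiction eq (All.lookup x∉ (∈-lookup j))
  lookup-injective (x∉ ∷ _)    (suc i) zero    eq = contradiction (≈-sym eq) (All.lookup x∉ (∈-lookup i))
  lookup-injective (_   ∷ xs!) (suc i) (suc j) eq = cong suc (lookup-injective xs! i j eq)

  -- The position that `complete` finds for `x` may depend on the proof of `P x` and on the
  -- representative of `x`; since `xs` has no repetition up to `≈`, it does not.
  enumeration⇒hasCardinality :
    {P : Pred Carrier p} {xs : List Carrier} → SetoidUnique.Unique S xs → All P xs →
    (∀ {x} → P x → x ∈ₛ xs) → Subset S P HasCardinality length xs
  enumeration⇒hasCardinality {P = P} {xs} xs! Pxs complete = record
    { to        = to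
    ; from      = λ i → lookup xs i , All.lookup Pxs (∈-lookup i)
    ; to-cong   = λ {x} {y} x≈y → lookup-injective xs! _ _
                    (≈-trans (≈-sym (found x)) (≈-trans x≈y (found y)))
    ; from-cong = λ { refl → ≈-refl }
    ; inverse   = (λ {i} {x} x≈ → lookup-injective xs! _ _ (≈-trans (≈-sym (found x)) x≈))
                , (λ { {x} refl → ≈-sym (found x) })
    }
    where
    to : ∃[ x ] P x → Fin (length xs)
    to (_ , Px) = Any.index (complete Px)

    found : ∀ x → proj₁ x ≈ lookup xs (to x)
    found (_ , Px) = Any.lookup-index (complete Px)

hasCardinality-unique : {S : Setoid a ℓ} {j k : ℕ} → S HasCardinality j → S HasCardinality k → j ≡ k
hasCardinality-unique S↔j S↔k = ↔⇒≡ (Composition.inverse (Symmetry.inverse S↔j) S↔k)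

concatMap⁺ : {R : Rel B r} (f : A → List B) {xs : List A} → (∀ x → AllPairs R (f x)) →
             AllPairs (λ x y → ∀ u v → u ∈ f x → v ∈ f y → R u v) xs →
             AllPairs R (concatMap f xs)
concatMap⁺ f {xs} Rf Rxs =
  AllPairs.concat⁺ (All.map⁺ (All.tabulate {xs = xs} λ {x} _ → Rf x))
    (AllPairs.map⁺ (AllPairs.map (λ R → All.tabulate λ u∈ → All.tabulate λ v∈ → R _ _ u∈ v∈) Rxs))

mapMaybe⁺ : {R : Rel A r} {S : Rel B s} {f : A → Maybe B} →
            (∀ {x y u v} → R x y → f x ≡ just u → f y ≡ just v → S u v) →
            ∀ {xs} → AllPairs R xs → AllPairs S (mapMaybe f xs)
mapMaybe⁺ {R = R} {S} {f} resp = go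
  where
  keep : ∀ {x u xs} → f x ≡ just u → All (R x) xs → All (S u) (mapMaybe f xs)
  keep fx []                           = []
  keep fx (_∷_ {x = y} Rxy Rx) with f y in fy
  ... | nothing = keep fx Rx
  ... | just _  = resp Rxy fx fy ∷ keep fx Rx

  go : ∀ {xs} → AllPairs R xs → AllPairs S (mapMaybe f xs)
  go []                       = []
  go (_∷_ {x = x} Rx Rxs) with f x in fx
  ... | nothing = go Rxs
  ... | just _  = keep fx Rx ∷ go Rxs

-- Enumeration of the symmetric group

insert-cong : ∀ {n} i j {π ρ : Permutation′ n} → π Perm.≈ ρ → insert i j π Perm.≈ insert i j ρ
insert-cong i j π≈ρ k with i Fin.≟ k
... | yes _   = refl
... | no  i≢k = cong (Fin.punchIn j) (π≈ρ (Fin.punchOut i≢k))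

insert-injective : ∀ {n} i j {π ρ : Permutation′ n} → insert i j π Perm.≈ insert i j ρ → π Perm.≈ ρ
insert-injective i j {π} {ρ} eq k = Fin.punchIn-injective j _ _
  (trans (sym (insert-punchIn i j π k)) (trans (eq _) (insert-punchIn i j ρ k)))

permutations-unique : ∀ n → SetoidUnique.Unique (Sym n) (permutations n)
permutations-unique zero    = [] ∷ []
permutations-unique (suc n) = concatMap⁺ {R = λ α β → ¬ (α Perm.≈ β)} _
  (λ α → AllPairs.map⁺ (AllPairs.map (λ j≢k eq → j≢k (eq zero)) (Unique.allFin⁺ (suc n))))
  (AllPairs.map
    (λ α≉β _ _ u∈ v∈ eq → disjoint α≉β (∈-map⁻ _ u∈) (∈-map⁻ _ v∈) eq)
    (permutations-unique n))
  where
  disjoint : ∀ {α β : Permutation′ n} {u v} → ¬ (α Perm.≈ β) →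
             ∃[ j ] (j ∈ allFin (suc n) × u ≡ insert zero j α) →
             ∃[ k ] (k ∈ allFin (suc n) × v ≡ insert zero k β) → ¬ (u Perm.≈ v)
  -- An inserted permutation sends `zero` to the chosen image, so evaluating there identifies `j`
  -- with `k`.
  disjoint {α} {β} α≉β (j , _ , refl) (k , _ , refl) eq with refl ← eq zero =
    α≉β (insert-injective zero j eq)

-- Deleting `zero` together with its image leaves a smaller permutation, and inserting the same
-- image again recovers `α`, though only pointwise.
∈-permutations : ∀ {n} (α : Permutation′ n) → Any (α Perm.≈_) (permutations n)
∈-permutations {zero}  α = here λ ()
∈-permutations {suc n} α = Any.concatMap⁺ _ (Any.map extend (∈-permutations (remove zero α)))
  where
  extend : ∀ {β} → remove zero α Perm.≈ β →
           Any (α Perm.≈_) (map (λ j → insert zero j β) (allFin (suc n)))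
  extend α≈β = Any.map⁺ (Any.map (λ { refl i → trans (sym (insert-remove zero α i)) (insert-cong zero _ α≈β i) })
                 (∈-allFin (α ⟨$⟩ʳ zero)))

-- Coefficients of products of binomials 1 + x^m

coeff-⊕ : ∀ p q k → coeff (p ⊕ q) k ≡ coeff p k + coeff q k
coeff-⊕ []      q       k       = refl
coeff-⊕ (a ∷ p) []      k       = sym (+-identityʳ _)
coeff-⊕ (a ∷ p) (b ∷ q) zero    = refl
coeff-⊕ (a ∷ p) (b ∷ q) (suc k) = coeff-⊕ p q k

coeff-scale : ∀ m p k → coeff (map (m *_) p) k ≡ m * coeff p k
coeff-scale m []      k       = sym (*-zeroʳ m)
coeff-scale m (a ∷ p) zero    = refl
coeff-scale m (a ∷ p) (suc k) = coeff-scale m p k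

coeff≢0⇒<length : ∀ p {k} → coeff p k ≢ 0 → k < length p
coeff≢0⇒<length []      {k}     c≢0 = contradiction refl c≢0
coeff≢0⇒<length (a ∷ p) {zero}  c≢0 = z<s
coeff≢0⇒<length (a ∷ p) {suc k} c≢0 = s<s (coeff≢0⇒<length p c≢0)

-- Polynomial identities are stated coefficientwise because list equality sees trailing zeros:
-- `(x^ 0) ⊗ []` is `0 ∷ []`, for instance.
coeff-distribʳ-⊕ : ∀ p q r k → coeff ((p ⊕ q) ⊗ r) k ≡ coeff (p ⊗ r) k + coeff (q ⊗ r) k
coeff-distribʳ-⊕ []      q       r k = refl
coeff-distribʳ-⊕ (a ∷ p) []      r k = sym (+-identityʳ _)
coeff-distribʳ-⊕ (a ∷ p) (b ∷ q) r k = begin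
  coeff (map ((a + b) *_) r ⊕ (0 ∷ (p ⊕ q) ⊗ r)) k
    ≡⟨ coeff-⊕ (map ((a + b) *_) r) _ k ⟩
  coeff (map ((a + b) *_) r) k + coeff (0 ∷ (p ⊕ q) ⊗ r) k
    ≡⟨ cong₂ _+_ (trans (coeff-scale (a + b) r k) (*-distribʳ-+ (coeff r k) a b)) (shifted k) ⟩
  (a * coeff r k + b * coeff r k) + (coeff (0 ∷ p ⊗ r) k + coeff (0 ∷ q ⊗ r) k)
    ≡⟨ interchange +-commutativeSemigroup (a * coeff r k) _ _ _ ⟩
  (a * coeff r k + coeff (0 ∷ p ⊗ r) k) + (b * coeff r k + coeff (0 ∷ q ⊗ r) k)
    ≡⟨ cong₂ _+_ (coeff-∷-⊗ a p) (coeff-∷-⊗ b q) ⟨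
  coeff ((a ∷ p) ⊗ r) k + coeff ((b ∷ q) ⊗ r) k ∎
  where
  open ≡-Reasoning

  shifted : ∀ k → coeff (0 ∷ (p ⊕ q) ⊗ r) k ≡ coeff (0 ∷ p ⊗ r) k + coeff (0 ∷ q ⊗ r) k
  shifted zero    = refl
  shifted (suc k) = coeff-distribʳ-⊕ p q r k

  coeff-∷-⊗ : ∀ a p → coeff ((a ∷ p) ⊗ r) k ≡ a * coeff r k + coeff (0 ∷ p ⊗ r) k
  coeff-∷-⊗ a p = trans (coeff-⊕ (map (a *_) r) _ k) (cong (_+ _) (coeff-scale a r k))

count : ℕ → List ℕ → ℕ
count k xs = length (filter (k ℕ.≟_) xs)

count-++ : ∀ k xs ys → count k (xs ++ ys) ≡ count k xs + count k ys
count-++ k xs ys = trans (cong length (filter-++ (k ℕ.≟_) xs ys)) (length-++ (filter (k ℕ.≟_) xs))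

count-∉ : ∀ {k xs} → k ∉ xs → count k xs ≡ 0
count-∉ {k} {xs} k∉ = cong length (filter-none (k ℕ.≟_) (All.¬Any⇒All¬ xs k∉))

count-unique-∈ : ∀ {k xs} → Unique xs → k ∈ xs → count k xs ≡ 1
count-unique-∈ {k} (x∉ ∷ xs!) (here refl) =
  trans (cong length (filter-accept (k ℕ.≟_) refl)) (cong suc (count-∉ (All.All¬⇒¬Any x∉)))
count-unique-∈ {k} (x∉ ∷ xs!) (there k∈) =
  trans (cong length (filter-reject (k ℕ.≟_) λ { refl → All.All¬⇒¬Any x∉ k∈ })) (count-unique-∈ xs! k∈)

count≢0⇒∈ : ∀ {k xs} → count k xs ≢ 0 → k ∈ xs
count≢0⇒∈ {k} {xs} c≢0 = decidable-stable (Any.any? (k ℕ.≟_) xs) (c≢0 ∘ count-∉)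

count-map-suc : ∀ k xs → count (suc k) (map suc xs) ≡ count k xs
count-map-suc k []       = refl
-- The test of `suc k` against `suc x` computes to `k ≡ᵇ x`, so both filters branch on the same
-- Boolean.
count-map-suc k (x ∷ xs) with k ≡ᵇ x
... | true  = cong suc (count-map-suc k xs)
... | false = count-map-suc k xs

count-zero-map-suc : ∀ xs → count 0 (map suc xs) ≡ 0
count-zero-map-suc xs = count-∉ {xs = map suc xs} λ 0∈ → case ∈-map⁻ suc 0∈ of λ { (_ , _ , ()) }

-- p = Σ_{m ∈ ms} x^m.
_HasExponents_ : Poly → List ℕ → Set
p HasExponents ms = ∀ k → coeff p k ≡ count k ms

1-hasExponents : (x^ 0) HasExponents (0 ∷ [])
1-hasExponents zero    = refl
1-hasExponents (suc k) = refl

shift-hasExponents : ∀ q ms → q HasExponents ms → ∀ m → ((x^ m) ⊗ q) HasExponents (map (m +_) ms)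
shift-hasExponents q ms q~ms zero k = begin
  coeff (map (1 *_) q ⊕ (0 ∷ [])) k ≡⟨ coeff-⊕ (map (1 *_) q) _ k ⟩
  coeff (map (1 *_) q) k + coeff (0 ∷ []) k ≡⟨ cong₂ _+_ (coeff-scale 1 q k) (zeros k) ⟩
  1 * coeff q k + 0                 ≡⟨ trans (+-identityʳ _) (*-identityˡ _) ⟩
  coeff q k                         ≡⟨ q~ms k ⟩
  count k ms                        ≡⟨ cong (count k) (map-id ms) ⟨
  count k (map (0 +_) ms)           ∎
  where
  open ≡-Reasoning
  zeros : ∀ k → coeff (0 ∷ []) k ≡ 0
  zeros zero    = refl
  zeros (suc k) = refl
shift-hasExponents q ms q~ms (suc m) k = begin
  coeff (map (0 *_) q ⊕ (0 ∷ (x^ m) ⊗ q)) k ≡⟨ coeff-⊕ (map (0 *_) q) _ k ⟩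
  coeff (map (0 *_) q) k + coeff (0 ∷ (x^ m) ⊗ q) k ≡⟨ cong (_+ coeff (0 ∷ (x^ m) ⊗ q) k) (coeff-scale 0 q k) ⟩
  coeff (0 ∷ (x^ m) ⊗ q) k          ≡⟨ step k ⟩
  count k (map suc (map (m +_) ms)) ≡⟨ cong (count k) (map-∘ ms) ⟨
  count k (map (suc m +_) ms)       ∎
  where
  open ≡-Reasoning
  step : ∀ k → coeff (0 ∷ (x^ m) ⊗ q) k ≡ count k (map suc (map (m +_) ms))
  step zero    = sym (count-zero-map-suc (map (m +_) ms))
  step (suc k) = trans (shift-hasExponents q ms q~ms m k) (sym (count-map-suc k (map (m +_) ms)))

1+x^-hasExponents : ∀ q ms → q HasExponents ms → ∀ m →
                    ((x^ 0 ⊕ x^ m) ⊗ q) HasExponents (ms ++ map (m +_) ms)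
1+x^-hasExponents q ms q~ms m k = begin
  coeff ((x^ 0 ⊕ x^ m) ⊗ q) k ≡⟨ coeff-distribʳ-⊕ (x^ 0) (x^ m) q k ⟩
  coeff ((x^ 0) ⊗ q) k + coeff ((x^ m) ⊗ q) k
    ≡⟨ cong₂ _+_ (shift-hasExponents q ms q~ms 0 k) (shift-hasExponents q ms q~ms m k) ⟩
  count k (map (0 +_) ms) + count k (map (m +_) ms) ≡⟨ cong (λ l → count k l + count k (map (m +_) ms)) (map-id ms) ⟩
  count k ms + count k (map (m +_) ms) ≡⟨ count-++ k ms _ ⟨
  count k (ms ++ map (m +_) ms) ∎
  where open ≡-Reasoning

-- One entry for each way of picking a term from every binomial, in the order in which the product
-- expands. Edge lists are kept instead of their weights because distinctness of the weights is
-- proved by looking at the edges.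
unions : List (List A) → List (List A)
unions []       = [] ∷ []
unions (z ∷ zs) = unions zs ++ map (z ++_) (unions zs)

W-++ : ∀ {n} (xs ys : List (Pair n)) → W (xs ++ ys) ≡ W xs + W ys
W-++ xs ys = trans (cong sum (map-++ w xs ys)) (sum-++ (map w xs) _)

product-hasExponents : ∀ {n} (zs : List (List (Pair n))) →
  foldr _⊗_ (x^ 0) (map (λ z → x^ 0 ⊕ x^ (W z)) zs) HasExponents map W (unions zs)
product-hasExponents []       k = 1-hasExponents k
product-hasExponents (z ∷ zs) k = begin
  _ ≡⟨ 1+x^-hasExponents _ (map W us) (product-hasExponents zs) (W z) k ⟩
  count k (map W us ++ map (W z +_) (map W us))
    ≡⟨ cong (λ ms → count k (map W us ++ ms)) (begin
      map (W z +_) (map W us)  ≡⟨ map-∘ us ⟨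
      map (λ u → W z + W u) us ≡⟨ map-cong (W-++ z) us ⟨
      map (W ∘ (z ++_)) us     ≡⟨ map-∘ us ⟩
      map W (map (z ++_) us)   ∎) ⟩
  count k (map W us ++ map W (map (z ++_) us)) ≡⟨ cong (count k) (map-++ W us _) ⟨
  count k (map W (us ++ map (z ++_) us)) ∎
  where
  open ≡-Reasoning
  us = unions zs

unions-⊆ : {xs : List A} (zs : List (List A)) → xs ∈ unions zs → ∀ {x} → x ∈ xs → x ∈ concat zs
unions-⊆ []       (here refl) ()
unions-⊆ (z ∷ zs) xs∈ x∈ with ∈-++⁻ (unions zs) xs∈
... | inj₁ xs∈ = ∈-++⁺ʳ z (unions-⊆ zs xs∈ x∈)
... | inj₂ z∷∈ with ys , ys∈ , refl ← ∈-map⁻ (z ++_) z∷∈ with ∈-++⁻ z x∈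
...   | inj₁ x∈z = ∈-++⁺ˡ x∈z
...   | inj₂ x∈ys = ∈-++⁺ʳ z (unions-⊆ zs ys∈ x∈ys)

-- Weights are distinct powers of two

suc-C-2 : ∀ n → suc n C 2 ≡ n + n C 2
suc-C-2 n = trans (sym (nCk+nC[k+1]≡[n+1]C[k+1] n 1)) (cong (_+ n C 2) (nC1≡n n))

C-2-mono : ∀ {m n} → m ≤ n → m C 2 ≤ n C 2
C-2-mono m≤n = go (≤⇒≤′ m≤n)
  where
  go : ∀ {m n} → m ≤′ n → m C 2 ≤ n C 2
  go (≤′-reflexive refl) = ≤-refl
  go {n = suc n} (≤′-step m≤n) = ≤-trans (go m≤n) (≤-trans (m≤n+m _ n) (≤-reflexive (sym (suc-C-2 n))))

-- Removes the truncated subtraction from the first factor of `position`, so that the ring solver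
-- applies to what remains.
2n∸i : ∀ a d → 2 * (a + suc d) ∸ suc a ≡ suc (a + 2 * d)
2n∸i a d = trans (cong (_∸ suc a) (identity a d)) (m+n∸m≡n (suc a) _)
  where
  identity : ∀ a d → 2 * (a + suc d) ≡ suc a + suc (a + 2 * d)
  identity = solve-∀

-- With n = a + suc d, the first summand of the position of a pair whose smaller
-- vertex is suc a equals t = n C 2 ∸ suc d C 2; in particular its halving is exact.
row-start : ∀ a d → ∃[ t ] ((2 * (a + suc d) ∸ suc a) * a ≡ t * 2 × t + suc d C 2 ≡ (a + suc d) C 2)
row-start zero    d = 0 , *-zeroʳ (2 * suc d ∸ 1) , refl
row-start (suc a) d with t , r≡2t , t+C≡C ← row-start a (suc d) = t + suc d , r′≡2t′ , t′+C≡C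
  where
  open ≡-Reasoning
  identity : ∀ a d → suc (suc a + 2 * d) * suc a ≡ suc (a + 2 * suc d) * a + suc d * 2
  identity = solve-∀

  r′≡2t′ : (2 * (suc a + suc d) ∸ suc (suc a)) * suc a ≡ (t + suc d) * 2
  r′≡2t′ = begin
    (2 * (suc a + suc d) ∸ suc (suc a)) * suc a         ≡⟨ cong (_* suc a) (2n∸i (suc a) d) ⟩
    suc (suc a + 2 * d) * suc a                         ≡⟨ identity a d ⟩
    suc (a + 2 * suc d) * a + suc d * 2                 ≡⟨ cong (λ m → m * a + suc d * 2) (2n∸i a (suc d)) ⟨
    (2 * (a + suc (suc d)) ∸ suc a) * a + suc d * 2     ≡⟨ cong (_+ suc d * 2) r≡2t ⟩
    t * 2 + suc d * 2                                   ≡⟨ *-distribʳ-+ 2 t (suc d) ⟨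
    (t + suc d) * 2                                     ∎

  t′+C≡C : t + suc d + suc d C 2 ≡ (suc a + suc d) C 2
  t′+C≡C = begin
    t + suc d + suc d C 2   ≡⟨ +-assoc t (suc d) _ ⟩
    t + (suc d + suc d C 2) ≡⟨ cong (t +_) (suc-C-2 (suc d)) ⟨
    t + suc (suc d) C 2     ≡⟨ t+C≡C ⟩
    (a + suc (suc d)) C 2   ≡⟨ cong (_C 2) (+-suc a (suc d)) ⟩
    (suc a + suc d) C 2     ∎

exponent : ∀ {n} → Pair n → ℕ
exponent {n} e = n C 2 ∸ position e

-- The first summand of `position` counts the pairs in earlier rows. Of all `n C 2` pairs this
-- leaves those whose smaller vertex is at least `lo e`, and `e` stands at place `hi e - lo e` among
-- them: the exponent is the number of pairs after `e` in lexicographic order.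
exponent-formula : ∀ {n} (e : Pair n) →
  exponent e ≡ (n ∸ toℕ (lo e)) C 2 ∸ (toℕ (hi e) ∸ toℕ (lo e))
exponent-formula {n} e with d , n≡ ← m≤n⇒∃[o]m+o≡n (Fin.toℕ<n (lo e)) = begin
  n C 2 ∸ (((2 * n ∸ suc i) * i) / 2 + k) ≡⟨ cong (λ n → n C 2 ∸ (((2 * n ∸ suc i) * i) / 2 + k)) n≡m ⟩
  m C 2 ∸ (((2 * m ∸ suc i) * i) / 2 + k) ≡⟨ cancel (row-start i d) ⟩
  suc d C 2 ∸ k                           ≡⟨ cong (λ l → l C 2 ∸ k) (m+n∸m≡n i (suc d)) ⟨
  (m ∸ i) C 2 ∸ k                         ≡⟨ cong (λ n → (n ∸ i) C 2 ∸ k) n≡m ⟨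
  (n ∸ i) C 2 ∸ k                         ∎
  where
  open ≡-Reasoning
  i = toℕ (lo e)
  k = toℕ (hi e) ∸ i
  m = i + suc d

  n≡m : n ≡ m
  n≡m = trans (sym n≡) (sym (+-suc i d))

  cancel : ∃[ t ] ((2 * m ∸ suc i) * i ≡ t * 2 × t + suc d C 2 ≡ m C 2) →
           m C 2 ∸ (((2 * m ∸ suc i) * i) / 2 + k) ≡ suc d C 2 ∸ k
  cancel (t , r≡2t , t+C≡C) = begin
    m C 2 ∸ (((2 * m ∸ suc i) * i) / 2 + k) ≡⟨ cong (λ r → m C 2 ∸ (r / 2 + k)) r≡2t ⟩
    m C 2 ∸ (t * 2 / 2 + k)                 ≡⟨ cong₂ (λ C s → C ∸ (s + k)) (sym t+C≡C) (m*n/n≡m t 2) ⟩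
    t + suc d C 2 ∸ (t + k)                 ≡⟨ [m+n]∸[m+o]≡n∸o t _ k ⟩
    suc d C 2 ∸ k                           ∎

infix 4 _≻_

_≻_ : ∀ {n} → Pair n → Pair n → Set
e ≻ f = exponent f < exponent e

hi∸lo<n∸lo : ∀ {n} (e : Pair n) → toℕ (hi e) ∸ toℕ (lo e) < n ∸ toℕ (lo e)
hi∸lo<n∸lo (pair i j i<j) = ∸-monoˡ-< (Fin.toℕ<n j) (<⇒≤ (recompute (toℕ i <? toℕ j) i<j))

0<hi∸lo : ∀ {n} (e : Pair n) → 0 < toℕ (hi e) ∸ toℕ (lo e)
0<hi∸lo (pair i j i<j) = m<n⇒0<n∸m (recompute (toℕ i <? toℕ j) i<j)

-- Guarantees that the outer subtraction of `exponent-formula` does not truncate; only then is it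
-- strictly monotone.
m<n⇒m≤nC2 : ∀ {m n} → m < n → m ≤ n C 2
m<n⇒m≤nC2 {m} {suc n} (s≤s m≤n) = ≤-trans m≤n (≤-trans (m≤m+n n _) (≤-reflexive (sym (suc-C-2 n))))

same-row-≻ : ∀ {n} {i j k : Fin n} .{i<j : i Fin.< j} .{i<k : i Fin.< k} →
             j Fin.< k → pair i j i<j ≻ pair i k i<k
same-row-≻ {n} {i} {j} {k} {i<j} {i<k} j<k =
  subst₂ _<_ (sym (exponent-formula f)) (sym (exponent-formula e))
    (∸-monoʳ-< (∸-monoˡ-< j<k (<⇒≤ (recompute (toℕ i <? toℕ j) i<j))) (m<n⇒m≤nC2 (hi∸lo<n∸lo f)))
  where
  e = pair i j i<j
  f = pair i k i<k

-- The value `d C 2` separates the rows: it counts the pairs in all rows after that of `e`, so it is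
-- the least exponent possible in that row and exceeds every exponent in a later one.
lo-<⇒≻ : ∀ {n} (e f : Pair n) → lo e Fin.< lo f → e ≻ f
lo-<⇒≻ {n} e f i<j = subst₂ _<_ (sym (exponent-formula f)) (sym (exponent-formula e)) (begin-strict
  (n ∸ j) C 2 ∸ (toℕ (hi f) ∸ j) <⟨ ∸-monoʳ-< (0<hi∸lo f) (m<n⇒m≤nC2 (hi∸lo<n∸lo f)) ⟩
  (n ∸ j) C 2                    ≤⟨ C-2-mono (∸-monoʳ-≤ n i<j) ⟩
  d C 2                          ≡⟨ m+n∸m≡n d _ ⟨
  d + d C 2 ∸ d                  ≡⟨ cong (_∸ d) (suc-C-2 d) ⟨
  suc d C 2 ∸ d                  ≡⟨ cong (λ m → m C 2 ∸ d) 1+d≡n∸i ⟩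
  (n ∸ i) C 2 ∸ d                ≤⟨ ∸-monoʳ-≤ ((n ∸ i) C 2) (s≤s⁻¹ (subst (toℕ (hi e) ∸ i <_) (sym 1+d≡n∸i) (hi∸lo<n∸lo e))) ⟩
  (n ∸ i) C 2 ∸ (toℕ (hi e) ∸ i) ∎)
  where
  open ≤-Reasoning
  i = toℕ (lo e)
  j = toℕ (lo f)
  d = n ∸ suc i

  1+d≡n∸i : suc d ≡ n ∸ i
  1+d≡n∸i = sym (+-∸-assoc 1 (Fin.toℕ<n (lo e)))

pair?-just : ∀ {n} {i j : Fin n} {e} → pair? i j ≡ just e → lo e ≡ i × hi e ≡ j
pair?-just {i = i} {j} eq with i Fin.<? j
pair?-just refl | yes _ = refl , refl

mapMaybe⁻ : ∀ {a b} {A : Set a} {B : Set b} (f : A → Maybe B) xs {y} →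
            y ∈ mapMaybe f xs → ∃[ x ] (x ∈ xs × f x ≡ just y)
mapMaybe⁻ f (x ∷ xs) y∈ with f x in fx | y∈
... | just _  | here refl = x , here refl , fx
... | just _  | there y∈ with x′ , x′∈ , fx′ ← mapMaybe⁻ f xs y∈ = x′ , there x′∈ , fx′
... | nothing | y∈       with x′ , x′∈ , fx′ ← mapMaybe⁻ f xs y∈ = x′ , there x′∈ , fx′

allFin-< : ∀ n → AllPairs Fin._<_ (allFin n)
allFin-< n = AllPairs.tabulate⁺-< λ i<j → i<j

-- The enumeration is lexicographic, so it runs through the weights in strictly decreasing order.
-- Both the absence of repetitions and the comparison of binary expansions rest on this.
pairs-≻ : ∀ n → AllPairs _≻_ (pairs n)
pairs-≻ n = concatMap⁺ (λ i → mapMaybe (pair? i) (allFin n))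
  (λ i → mapMaybe⁺ (λ {_} {_} {e} {f} j<k eq eq′ → row {e = e} {f} j<k (pair?-just eq) (pair?-just eq′)) (allFin-< n))
  (AllPairs.map (λ i<i′ e f e∈ f∈ → rows i<i′ (mapMaybe⁻ _ _ e∈) (mapMaybe⁻ _ _ f∈)) (allFin-< n))
  where
  row : ∀ {i j k : Fin n} {e f} → j Fin.< k → lo e ≡ i × hi e ≡ j → lo f ≡ i × hi f ≡ k → e ≻ f
  row {e = pair _ _ i<j} {pair _ _ i<k} j<k (refl , refl) (refl , refl) = same-row-≻ {i<j = i<j} {i<k} j<k

  rows : ∀ {i i′ : Fin n} {e f} → i Fin.< i′ →
         ∃[ j ] (j ∈ allFin n × pair? i j ≡ just e) → ∃[ k ] (k ∈ allFin n × pair? i′ k ≡ just f) → e ≻ f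
  rows {e = e} {f} i<i′ (_ , _ , eq) (_ , _ , eq′)
    with refl , _ ← pair?-just eq | refl , _ ← pair?-just eq′ = lo-<⇒≻ e f i<i′

pairs-unique : ∀ n → Unique (pairs n)
pairs-unique n = AllPairs.map (λ { e≻e refl → <-irrefl refl e≻e }) (pairs-≻ n)

∈-pairs : ∀ {n} (e : Pair n) → e ∈ pairs n
∈-pairs {n} (pair i j i<j) = ∈-concatMap⁺ (λ i → mapMaybe (pair? i) (allFin n))
  (lose (∈-allFin i) (Any.mapMaybe⁺ (pair? i) (allFin n) (Any.map⁺ (lose (∈-allFin j) found))))
  where
  found : Maybe.Any (pair i j i<j ≡_) (pair? i j)
  found with i Fin.<? j
  ... | yes _  = Maybe.just refl
  ... | no i≮j = contradiction (recompute (toℕ i <? toℕ j) i<j) i≮j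

-- Labels and edge lists

label : ∀ {n} → Graph n → ℕ
label {n} G = W (filterᵇ G (pairs n))

-- A sum of distinct powers of two stays below the next power. For the tail the bound drops to the
-- exponent of the head, which is what `e≻` provides.
W-filter-< : ∀ {n} (G : Graph n) {es k} → AllPairs _≻_ es → All (λ e → exponent e < k) es →
             W (filterᵇ G es) < 2 ^ k
W-filter-< G {k = k} [] [] = m^n>0 2 k
W-filter-< G {e ∷ es} {k} (e≻ ∷ es≻) (e<k ∷ _) with IH ← W-filter-< G es≻ e≻ | G e
... | false = <-trans IH (^-monoʳ-< 2 (s≤s z<s) e<k)
... | true  = begin-strict
  2 ^ exponent e + W (filterᵇ G es) <⟨ +-monoʳ-< (2 ^ exponent e) IH ⟩
  2 ^ exponent e + 2 ^ exponent e   ≡⟨ cong (2 ^ exponent e +_) (+-identityʳ _) ⟨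
  2 ^ suc (exponent e)              ≤⟨ ^-monoʳ-≤ 2 e<k ⟩
  2 ^ k                             ∎
  where open ≤-Reasoning

-- By W-filter-<, the weight of the first pair exceeds the total weight of all later
-- ones, so the first pair is decided by comparing the two sums.
W-filter-injective : ∀ {n} (G H : Graph n) {es} → AllPairs _≻_ es →
                     W (filterᵇ G es) ≡ W (filterᵇ H es) → ∀ {e} → e ∈ es → G e ≡ H e
W-filter-injective G H {e ∷ es} (e≻ ∷ es≻) eq f∈
  with G e in Ge | H e in He | W-filter-< G es≻ e≻ | W-filter-< H es≻ e≻
... | false | true | <ᴳ | _ =
  contradiction (<-≤-trans <ᴳ (≤-trans (m≤m+n _ _) (≤-reflexive (sym eq)))) (<-irrefl refl)
... | true | false | _ | <ᴴ =
  contradiction (<-≤-trans <ᴴ (≤-trans (m≤m+n _ _) (≤-reflexive eq))) (<-irrefl refl)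
W-filter-injective G H (_ ∷ _) _ (here refl) | false | false | _ | _ = trans Ge (sym He)
W-filter-injective G H (_ ∷ es≻) eq (there f∈) | false | false | _ | _ =
  W-filter-injective G H es≻ eq f∈
W-filter-injective G H (_ ∷ _) _ (here refl) | true | true | _ | _ = trans Ge (sym He)
W-filter-injective G H {e ∷ es} (_ ∷ es≻) eq (there f∈) | true | true | _ | _ =
  W-filter-injective G H es≻ (+-cancelˡ-≡ (w e) _ _ eq) f∈

label-injective : ∀ {n} (G H : Graph n) → label G ≡ label H → ∀ e → G e ≡ H e
label-injective {n} G H eq e = W-filter-injective G H (pairs-≻ n) eq (∈-pairs e)

label-cong : ∀ {n} {G H : Graph n} → (∀ e → G e ≡ H e) → label G ≡ label H
label-cong {n} {G} {H} G≗H = cong W (filter-≐ (Bool.T? ∘ G) (Bool.T? ∘ H)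
  ((λ {e} → subst T (G≗H e)) , (λ {e} → subst T (sym (G≗H e)))) (pairs n))

_IsEdgeListOf_ : ∀ {n} → List (Pair n) → Graph n → Set
es IsEdgeListOf G = ∀ {e} → e ∈ es ⇔ T (G e)

-- Duplicate-free lists with the same members are permutations of each other, and a sum ignores
-- order.
W-edgeList : ∀ {n} {es : List (Pair n)} {G} → Unique es → es IsEdgeListOf G → W es ≡ label G
W-edgeList {n} {es} {G} es! es~G = sum-↭ (↭.map⁺ w (∼bag⇒↭ (WithK.unique∧set⇒bag es!
  (Unique.filter⁺ (Bool.T? ∘ G) (pairs-unique n))
  (mk⇔ (λ e∈ → ∈-filter⁺ (Bool.T? ∘ G) (∈-pairs _) (Equivalence.to es~G e∈))
       (λ e∈ → Equivalence.from es~G (proj₂ (∈-filter⁻ (Bool.T? ∘ G) {xs = pairs n} e∈)))))))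

T-does⁺ : ∀ {a} {A : Set a} (a? : Dec A) → A → T (does a?)
T-does⁺ (yes _) _ = _
T-does⁺ (no ¬a) a = contradiction a ¬a

T-does⁻ : ∀ {a} {A : Set a} (a? : Dec A) → T (does a?) → A
T-does⁻ (yes a) _ = a

module _ {n : ℕ} where
  open DecMembership (_≟_ {n}) using (_∈?_)

  graph : List (Pair n) → Graph n
  graph es e = does (e ∈? es)

  graph-edgeList : ∀ es → es IsEdgeListOf graph es
  graph-edgeList es {e} = mk⇔ (T-does⁺ (e ∈? es)) (T-does⁻ (e ∈? es))

-- The list `es` is an edge list of `graph es`, so its weight is a label and injectivity of `label`
-- identifies the two graphs.
W-injective : ∀ {n} {es : List (Pair n)} {G} → Unique es → W es ≡ label G → es IsEdgeListOf G
W-injective {es = es} {G} es! eq {e} = subst (λ b → e ∈ es ⇔ T b)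
  (label-injective (graph es) G (trans (sym (W-edgeList es! (graph-edgeList es))) eq) e) (graph-edgeList es)

-- Orbits of an injective map on a finite set

deduplicate-AllPairs : {R : A → A → Set r} (R? : ∀ x y → Dec (R x y)) → ∀ xs →
                       AllPairs (λ x y → ¬ R x y) (deduplicate R? xs)
deduplicate-AllPairs R? []       = []
deduplicate-AllPairs R? (x ∷ xs) =
  All.all-filter _ (deduplicate R? xs) ∷ AllPairs.filter⁺ _ (deduplicate-AllPairs R? xs)

module Orbits {a} {A : Set a} (_≟_ : DecidableEquality A) (g : A → A)
  (g-injective : ∀ {x y} → g x ≡ g y → x ≡ y)
  (elements : List A) (complete : ∀ x → x ∈ elements) where

  open DecMembership _≟_ using (_∈?_)

  -- Agrees with `cycle` by definition when `g` is `α ′`, and `orbits` then agrees with `Z`, so the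
  -- results below apply to them directly.
  orbit : A → List A
  orbit e = e ∷ takeWhile (λ f → ¬? (f ≟ e)) (List.iterate g (g e) (length elements))

  iterate-comm : ∀ x k → iterate g (g x) k ≡ g (iterate g x k)
  iterate-comm x zero    = refl
  iterate-comm x (suc k) = iterate-comm (g x) k

  iterate-+ : ∀ x j k → iterate g x (j + k) ≡ iterate g (iterate g x j) k
  iterate-+ x zero    k = refl
  iterate-+ x (suc j) k = iterate-+ (g x) j k

  iterate-injective : ∀ {x y} k → iterate g x k ≡ iterate g y k → x ≡ y
  iterate-injective zero    eq = eq
  iterate-injective (suc k) eq = g-injective (iterate-injective k eq)

  -- Among the iterates with index 0 to `length elements` two coincide by the pigeonhole principle.
  -- Cancelling the shorter iteration by injectivity leaves a return to `e`, early enough for the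
  -- bounded list in `orbit` to contain it.
  returns : ∀ e → ∃[ d ] (d < length elements × iterate g (g e) d ≡ e)
  returns e with i , j , i<j , same ← Fin.pigeonhole (n<1+n (length elements))
                   (λ i → Any.index (complete (iterate g e (toℕ i))))
    with d , 1+i+d≡j ← m≤n⇒∃[o]m+o≡n i<j =
    d , d<N , sym (iterate-injective (toℕ i) (begin
      iterate g e (toℕ i)                   ≡⟨ SetoidMembershipProperties.index-injective (setoid A) (complete _) (complete _) same ⟩
      iterate g e (toℕ j)                   ≡⟨ cong (iterate g e) (trans (sym 1+i+d≡j) (+-comm (suc (toℕ i)) d)) ⟩
      iterate g e (d + suc (toℕ i))         ≡⟨ cong (iterate g e) (+-suc d (toℕ i)) ⟩
      iterate g (g e) (d + toℕ i)           ≡⟨ iterate-+ (g e) d (toℕ i) ⟩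
      iterate g (iterate g (g e) d) (toℕ i) ∎))
    where
    open ≡-Reasoning
    d<N : d < length elements
    d<N = ≤-trans (s≤s (m≤n+m d (toℕ i))) (≤-trans (≤-reflexive 1+i+d≡j) (s≤s⁻¹ (Fin.toℕ<n j)))

  -- Some return at `d < N` ensures that `takeWhile` stops at an occurrence of `e` and not at the
  -- end of the list; the place `m` where it stops is the first return.
  takeWhile-iterate : ∀ {e} N d x → d < N → iterate g x d ≡ e →
    ∃[ m ] (takeWhile (λ f → ¬? (f ≟ e)) (List.iterate g x N) ≡ List.iterate g x m
            × iterate g x m ≡ e × (∀ i → i < m → iterate g x i ≢ e))
  takeWhile-iterate {e} (suc N) d x d<N eq with x ≟ e
  ... | yes x≡e = 0 , refl , x≡e , λ _ ()
  takeWhile-iterate     (suc N) zero x _ eq | no x≢e = contradiction eq x≢e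
  takeWhile-iterate     (suc N) (suc d) x d<N eq | no x≢e
    with m , list , return , before ← takeWhile-iterate N d (g x) (s<s⁻¹ d<N) eq =
    suc m , cong (x ∷_) list , return , λ { zero _ → x≢e ; (suc i) i<m → before i (s<s⁻¹ i<m) }

  ∈-iterate⁺ : ∀ x {i k} → i < k → iterate g x i ∈ List.iterate g x k
  ∈-iterate⁺ x {zero}  {suc k} _   = here refl
  ∈-iterate⁺ x {suc i} {suc k} i<k = there (∈-iterate⁺ (g x) (s<s⁻¹ i<k))

  ∈-iterate⁻ : ∀ x k {y} → y ∈ List.iterate g x k → ∃[ i ] (i < k × y ≡ iterate g x i)
  ∈-iterate⁻ x (suc k) (here refl) = 0 , z<s , refl
  ∈-iterate⁻ x (suc k) (there y∈) with i , i<k , eq ← ∈-iterate⁻ (g x) k y∈ = suc i , s<s i<k , eq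

  -- The hypothesis passes from `x` to `g x`: a return to `g x` yields one to `x` after cancelling
  -- `g`.
  iterate-unique : ∀ x k → (∀ i → suc i < k → iterate g x (suc i) ≢ x) → Unique (List.iterate g x k)
  iterate-unique x zero    _         = []
  iterate-unique x (suc k) no-return =
    All.tabulate (λ y∈ x≡y → distinct x≡y (∈-iterate⁻ (g x) k y∈)) ∷
    iterate-unique (g x) k λ i i<k eq →
      no-return i (m<n⇒m<1+n i<k) (g-injective (trans (sym (iterate-comm x (suc i))) eq))
    where
    distinct : ∀ {y} → x ≡ y → ¬ (∃[ i ] (i < k × y ≡ iterate g (g x) i))
    distinct refl (i , i<k , eq) = no-return i (s<s i<k) (sym eq)

  -- The length of the cycle is `suc last`, so `last` is the index of the predecessor of `e`.
  record Period (e : A) : Set a where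
    field
      last    : ℕ
      list    : orbit e ≡ List.iterate g e (suc last)
      return  : iterate g e (suc last) ≡ e
      minimal : ∀ i → i < last → iterate g e (suc i) ≢ e

  period : ∀ e → Period e
  period e with d , d<N , eq ← returns e
    with m , list , return , before ← takeWhile-iterate (length elements) d (g e) d<N eq = record
    { last = m ; list = cong (e ∷_) list ; return = return ; minimal = before }

  orbit-unique : ∀ e → Unique (orbit e)
  orbit-unique e = subst Unique (sym list) (iterate-unique e (suc last) (λ i i<m → minimal i (s<s⁻¹ i<m)))
    where open Period (period e)

  g-surjective : ∀ e → ∃[ f ] g f ≡ e
  g-surjective e = iterate g e last , trans (sym (iterate-comm e last)) return
    where open Period (period e)

  ∈-orbit⁻ : ∀ {e f} → f ∈ orbit e → ∃[ i ] (i < suc (Period.last (period e)) × f ≡ iterate g e i)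
  ∈-orbit⁻ {e} {f} f∈ = ∈-iterate⁻ e (suc last) (subst (f ∈_) list f∈)
    where open Period (period e)

  orbit-closed : ∀ {e f} → f ∈ orbit e → g f ∈ orbit e
  orbit-closed {e} {f} f∈ = let i , i<1+m , f≡ = ∈-orbit⁻ f∈ in
    subst (_∈ orbit e) (trans (iterate-comm e i) (cong g (sym f≡))) (next i (m<1+n⇒m<n∨m≡n i<1+m))
    where
    open Period (period e)
    next : ∀ i → i < last ⊎ i ≡ last → iterate g e (suc i) ∈ orbit e
    next i (inj₁ i<m)  = subst (iterate g e (suc i) ∈_) (sym list) (∈-iterate⁺ e (s<s i<m))
    next i (inj₂ refl) = here return

  iterate-∈-orbit : ∀ e k → iterate g e k ∈ orbit e
  iterate-∈-orbit e zero    = here refl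
  iterate-∈-orbit e (suc k) =
    subst (_∈ orbit e) (sym (iterate-comm e k)) (orbit-closed (iterate-∈-orbit e k))

  orbit-trans : ∀ {e f h} → f ∈ orbit e → h ∈ orbit f → h ∈ orbit e
  orbit-trans {e} {f} {h} f∈ h∈ = compose (∈-orbit⁻ f∈) (∈-orbit⁻ h∈)
    where
    compose : ∃[ i ] (i < suc (Period.last (period e)) × f ≡ iterate g e i) →
              ∃[ j ] (j < suc (Period.last (period f)) × h ≡ iterate g f j) → h ∈ orbit e
    compose (i , _ , refl) (j , _ , refl) = subst (_∈ orbit e) (iterate-+ e i j) (iterate-∈-orbit e (i + j))

  orbit-sym : ∀ {e f} → f ∈ orbit e → e ∈ orbit f
  orbit-sym {e} {f} f∈ = back (∈-orbit⁻ f∈)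
    where
    open Period (period e)
    open ≡-Reasoning
    back : ∃[ i ] (i < suc last × f ≡ iterate g e i) → e ∈ orbit f
    -- The remaining `suc last ∸ i` steps complete the period and lead from `f` back to `e`.
    back (i , i<1+m , refl) = subst (_∈ orbit f) (begin
      iterate g (iterate g e i) (suc last ∸ i) ≡⟨ iterate-+ e i _ ⟨
      iterate g e (i + (suc last ∸ i))         ≡⟨ cong (iterate g e) (m+[n∸m]≡n (<⇒≤ i<1+m)) ⟩
      iterate g e (suc last)                   ≡⟨ return ⟩
      e                                        ∎) (iterate-∈-orbit f (suc last ∸ i))

  orbit-reflects : ∀ {e f} → g f ∈ orbit e → f ∈ orbit e
  orbit-reflects {f = f} gf∈ = orbit-trans gf∈ (orbit-sym (iterate-∈-orbit f 1))

  orbit-invariant : ∀ {b} {B : Set b} (h : A → B) → (∀ x → h (g x) ≡ h x) →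
                    ∀ {e f} → f ∈ orbit e → h f ≡ h e
  orbit-invariant h invariant {e} {f} f∈ = let i , _ , f≡ = ∈-orbit⁻ f∈ in trans (cong h f≡) (go e i)
    where
    go : ∀ e k → h (iterate g e k) ≡ h e
    go e zero    = refl
    go e (suc k) = trans (go (g e) k) (invariant e)

  representatives : List A
  representatives = deduplicate (λ e f → f ∈? orbit e) elements

  orbits : List (List A)
  orbits = map orbit representatives

  orbits-cover : ∀ f → f ∈ List.concat orbits
  orbits-cover f = ∈-concatMap⁺ orbit
    (Any.deduplicate⁺ (λ e f → f ∈? orbit e) (λ e∈ f∈ → orbit-trans e∈ f∈)
      (Any.map (λ { refl → here refl }) (complete f)))

  all-orbits : ∀ {p} (P : Pred (List A) p) → (∀ e → P (orbit e)) → All P orbits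
  all-orbits P Porbit = All.map⁺ (All.tabulate {P = P ∘ orbit} λ {e} _ → Porbit e)

  orbits-unique : All Unique orbits
  orbits-unique = all-orbits Unique orbit-unique

  orbits-nonempty : All (λ z → ∃[ e ] e ∈ z) orbits
  orbits-nonempty = all-orbits (λ z → ∃[ e ] e ∈ z) λ e → e , here refl

  -- A common element would put the later representative into the orbit of the earlier one, and
  -- `deduplicate` would have dropped it.
  orbits-disjoint : AllPairs Disjoint orbits
  orbits-disjoint = AllPairs.map⁺ (AllPairs.map disjoint
    (deduplicate-AllPairs (λ e f → f ∈? orbit e) elements))
    where
    disjoint : ∀ {e f} → f ∉ orbit e → Disjoint (orbit e) (orbit f)
    disjoint f∉ (h∈e , h∈f) = f∉ (orbit-trans h∈e (orbit-sym h∈f))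

-- Unions of disjoint blocks

unions-unique : (zs : List (List A)) → All Unique zs → AllPairs Disjoint zs → All Unique (unions zs)
unions-unique []       []         []             = [] ∷ []
unions-unique (z ∷ zs) (z! ∷ zs!) (z#zs ∷ zs#zs) = All.++⁺ us! (All.map⁺ (All.tabulate λ u∈ →
  Unique.++⁺ z! (All.lookup us! u∈) λ (x∈z , x∈u) → Disjoint.concat⁺ʳ z#zs (x∈z , unions-⊆ zs u∈ x∈u)))
  where us! = unions-unique zs zs! zs#zs

unions-resp : ∀ {x y} (zs : List (List A)) → (∀ {z} → z ∈ zs → x ∈ z → y ∈ z) →
              ∀ {u} → u ∈ unions zs → x ∈ u → y ∈ u
unions-resp []       _    (here refl) ()
unions-resp (z ∷ zs) resp u∈ x∈u with ∈-++⁻ (unions zs) u∈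
... | inj₁ u∈zs = unions-resp zs (resp ∘ there) u∈zs x∈u
... | inj₂ z++v∈ with v , v∈ , refl ← ∈-map⁻ (z ++_) z++v∈ with ∈-++⁻ z x∈u
...   | inj₁ x∈z = ∈-++⁺ˡ (resp (here refl) x∈z)
...   | inj₂ x∈v = ∈-++⁺ʳ z (unions-resp zs (resp ∘ there) v∈ x∈v)

-- The witness joins exactly the blocks on which `P` holds throughout.
∈-unions : ∀ {p} {P : A → Set p} (zs : List (List A)) →
           All (λ z → (∀ {x} → x ∈ z → P x) ⊎ (∀ {x} → x ∈ z → ¬ P x)) zs →
           ∃[ u ] (u ∈ unions zs × (∀ {x} → x ∈ u ⇔ (x ∈ concat zs × P x)))
∈-unions []       []          = [] , here refl , mk⇔ (λ ()) λ ()
∈-unions {P = P} (z ∷ zs) (const ∷ consts) with u , u∈ , u~ ← ∈-unions zs consts | const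
... | inj₁ all = z ++ u , ∈-++⁺ʳ (unions zs) (∈-map⁺ (z ++_) u∈) , mk⇔ to from
  where
  to : ∀ {x} → x ∈ z ++ u → x ∈ z ++ concat zs × P x
  to x∈ with ∈-++⁻ z x∈
  ... | inj₁ x∈z = ∈-++⁺ˡ x∈z , all x∈z
  ... | inj₂ x∈u with x∈zs , Px ← Equivalence.to u~ x∈u = ∈-++⁺ʳ z x∈zs , Px

  from : ∀ {x} → x ∈ z ++ concat zs × P x → x ∈ z ++ u
  from (x∈ , Px) with ∈-++⁻ z x∈
  ... | inj₁ x∈z  = ∈-++⁺ˡ x∈z
  ... | inj₂ x∈zs = ∈-++⁺ʳ z (Equivalence.from u~ (x∈zs , Px))
... | inj₂ none = u , ∈-++⁺ˡ u∈ , mk⇔ to from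
  where
  to : ∀ {x} → x ∈ u → x ∈ z ++ concat zs × P x
  to x∈u with x∈zs , Px ← Equivalence.to u~ x∈u = ∈-++⁺ʳ z x∈zs , Px

  from : ∀ {x} → x ∈ z ++ concat zs × P x → x ∈ u
  from (x∈ , Px) with ∈-++⁻ z x∈
  ... | inj₁ x∈z  = contradiction Px (none x∈z)
  ... | inj₂ x∈zs = Equivalence.from u~ (x∈zs , Px)

-- This is why the coefficients of a single `Fₐ α` are 0 or 1. Nonemptiness matters: an empty block
-- has weight 0 and would double every exponent.
W-unions-unique : (zs : List (List (Pair n))) → All Unique zs → AllPairs Disjoint zs →
                  All (λ z → ∃[ e ] e ∈ z) zs → Unique (map W (unions zs))
W-unions-unique []       _          _              _                     = [] ∷ []
W-unions-unique (z ∷ zs) zs!@(_ ∷ zs!′) zs#@(z#zs ∷ zs#′) ((e , e∈z) ∷ nonempty) =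
  subst Unique (sym (map-++ W us (map (z ++_) us)))
    (Unique.++⁺ IH
      (subst Unique W-shift (Unique.map⁺ (ℕ.+-cancelˡ-≡ (W z) _ _) IH))
      λ (k∈ , k∈′) → disjoint (∈-map⁻ W k∈) (∈-map⁻ W k∈′))
  where
  us = unions zs
  IH = W-unions-unique zs zs!′ zs#′ nonempty

  W-shift : map (W z +_) (map W us) ≡ map W (map (z ++_) us)
  W-shift = trans (sym (map-∘ us)) (trans (sym (map-cong (W-++ z) us)) (map-∘ us))

  us! : All Unique (unions (z ∷ zs))
  us! = unions-unique (z ∷ zs) zs! zs#

  -- Equal weights would make u and z ++ … lists of the same edges, but z meets only the latter.
  disjoint : ∀ {k} → ∃[ u ] (u ∈ us × k ≡ W u) → ¬ (∃[ v ] (v ∈ map (z ++_) us × k ≡ W v))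
  disjoint (u , u∈ , refl) (v , v∈ , eq) with _ , _ , refl ← ∈-map⁻ (z ++_) v∈ =
    Disjoint.concat⁺ʳ z#zs (e∈z , unions-⊆ zs u∈ (Equivalence.from (graph-edgeList u) (Equivalence.to v~u (∈-++⁺ˡ e∈z))))
    where
    v~u : v IsEdgeListOf graph u
    v~u = W-injective (All.lookup us! (∈-++⁺ʳ us v∈))
      (trans (sym eq) (W-edgeList (All.lookup us! (∈-++⁺ˡ u∈)) (graph-edgeList u)))

-- Graphs fixed by a permutation

pair-≡ : ∀ {e f : Pair n} → lo e ≡ lo f → hi e ≡ hi f → e ≡ f
pair-≡ refl refl = refl

⁅⁆-cong : ∀ {i j k l : Fin n} .{i≢j : i ≢ j} .{k≢l : k ≢ l} → i ≡ k → j ≡ l → ⁅ i , j ⁆ i≢j ≡ ⁅ k , l ⁆ k≢l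
⁅⁆-cong refl refl = refl

⁅⁆-ends : ∀ (i j : Fin n) .(i≢j : i ≢ j) → let e = ⁅ i , j ⁆ i≢j in
          (lo e ≡ i × hi e ≡ j) ⊎ (lo e ≡ j × hi e ≡ i)
⁅⁆-ends i j i≢j with Fin.<-cmp i j
... | tri< _ _   _ = inj₁ (refl , refl)
... | tri≈ _ i≡j _ = ⊥-elim-irr (i≢j i≡j)
... | tri> _ _   _ = inj₂ (refl , refl)

⁅⁆-injective : ∀ {i j k l : Fin n} .{i≢j : i ≢ j} .{k≢l : k ≢ l} → ⁅ i , j ⁆ i≢j ≡ ⁅ k , l ⁆ k≢l →
               (i ≡ k × j ≡ l) ⊎ (i ≡ l × j ≡ k)
⁅⁆-injective {i = i} {j} {k} {l} {i≢j} {k≢l} eq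
  -- With both pairs abstracted, the equations for their ends can be matched without splitting the
  -- two trichotomies.
  with ⁅ i , j ⁆ i≢j | ⁅ k , l ⁆ k≢l | ⁅⁆-ends i j i≢j | ⁅⁆-ends k l k≢l | eq
... | _ | _ | inj₁ (refl , refl) | inj₁ (refl , refl) | refl = inj₁ (refl , refl)
... | _ | _ | inj₁ (refl , refl) | inj₂ (refl , refl) | refl = inj₂ (refl , refl)
... | _ | _ | inj₂ (refl , refl) | inj₁ (refl , refl) | refl = inj₂ (refl , refl)
... | _ | _ | inj₂ (refl , refl) | inj₂ (refl , refl) | refl = inj₁ (refl , refl)

′-cong : ∀ {α β : Permutation′ n} → α Perm.≈ β → ∀ e → (α ′) e ≡ (β ′) e
′-cong α≈β (pair i j _) = ⁅⁆-cong (α≈β i) (α≈β j)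

permutation-injective : ∀ (α : Permutation′ n) {i j} → α ⟨$⟩ʳ i ≡ α ⟨$⟩ʳ j → i ≡ j
permutation-injective α = Injection.injective (↔⇒↣ α)

′-injective : ∀ (α : Permutation′ n) {e f} → (α ′) e ≡ (α ′) f → e ≡ f
′-injective α {pair i j i<j} {pair k l k<l} eq with ⁅⁆-injective eq
... | inj₁ (αi≡αk , αj≡αl) = pair-≡ (permutation-injective α αi≡αk) (permutation-injective α αj≡αl)
-- A crossed match would make the smaller vertex of each pair the larger one of the other.
... | inj₂ (αi≡αl , αj≡αk) with refl ← permutation-injective α αi≡αl | refl ← permutation-injective α αj≡αk =
  ⊥-elim-irr (Fin.<-asym i<j k<l)

module Cycles {n} (α : Permutation′ n) = Orbits (_≟_ {n}) (α ′) (′-injective α) (pairs n) ∈-pairs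

T-⇔⇒≡ : ∀ {a b} → T a ⇔ T b → a ≡ b
T-⇔⇒≡ {true}  {true}  _   = refl
T-⇔⇒≡ {true}  {false} a⇔b = contradiction _ (Equivalence.to a⇔b)
T-⇔⇒≡ {false} {true}  a⇔b = contradiction _ (Equivalence.from a⇔b)
T-⇔⇒≡ {false} {false} _   = refl

Fixes : Permutation′ n → Graph n → Set
Fixes α G = ∀ e → (α · G) e ≡ G e

·-edge⁺ : ∀ (α : Permutation′ n) G {e} → T (G e) → T ((α · G) ((α ′) e))
·-edge⁺ α G {e} Ge = Any.any⁺ _ (lose (∈-pairs e) (Equivalence.from Bool.T-∧ (Ge , T-does⁺ ((α ′) e ≟ (α ′) e) refl)))

·-edge⁻ : ∀ (α : Permutation′ n) G {e} → T ((α · G) e) → ∃[ f ] (T (G f) × (α ′) f ≡ e)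
·-edge⁻ {n} α G {e} αGe with f , _ , Gf∧ ← find (Any.any⁻ _ (pairs n) αGe)
  with Gf , eq ← Equivalence.to Bool.T-∧ Gf∧ = f , Gf , T-does⁻ ((α ′) f ≟ e) eq

-- Invariance is the form in which cycles can be used. This direction rests on injectivity of `α ′`,
-- the converse on its surjectivity.
fixes⇒invariant : ∀ (α : Permutation′ n) G → Fixes α G → ∀ e → G ((α ′) e) ≡ G e
fixes⇒invariant α G fixes e = T-⇔⇒≡ (mk⇔
  (λ Gαe → preimage (·-edge⁻ α G (subst T (sym (fixes _)) Gαe)))
  (λ Ge → subst T (fixes _) (·-edge⁺ α G Ge)))
  where
  preimage : ∃[ f ] (T (G f) × (α ′) f ≡ (α ′) e) → T (G e)
  preimage (f , Gf , eq) = subst (T ∘ G) (′-injective α eq) Gf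

invariant⇒fixes : ∀ (α : Permutation′ n) G → (∀ e → G ((α ′) e) ≡ G e) → Fixes α G
invariant⇒fixes α G invariant e = T-⇔⇒≡ (mk⇔
  (λ αGe → image (·-edge⁻ α G αGe))
  (λ Ge → preimage (Cycles.g-surjective α e) Ge))
  where
  image : ∃[ f ] (T (G f) × (α ′) f ≡ e) → T (G e)
  image (f , Gf , refl) = subst T (sym (invariant f)) Gf

  preimage : ∃[ f ] (α ′) f ≡ e → T (G e) → T ((α · G) e)
  preimage (f , refl) Gαf = ·-edge⁺ α G (subst T (invariant f) Gαf)

fixes? : (G : Graph n) → ∀ α → Dec (Fixes α G)
fixes? {n} G α = map′ (λ all e → All.lookup all (∈-pairs e)) (λ fixes → All.tabulate λ {e} _ → fixes e)
  (All.all? (λ e → (α · G) e Bool.≟ G e) (pairs n))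

-- The list `permutations n` contains a given permutation only up to `Perm._≈_`, so membership in
-- `stabiliser G` has to be transported along it.
fixes-cong : ∀ (G : Graph n) {α β} → α Perm.≈ β → Fixes α G → Fixes β G
fixes-cong G {α} {β} α≈β fixes = invariant⇒fixes β G λ e →
  trans (cong G (sym (′-cong {α = α} {β} α≈β e))) (fixes⇒invariant α G fixes e)

-- Coefficients of Fₐ and F

module _ {n} (α : Permutation′ n) where
  open Cycles α

  coeff-Fₐ : Fₐ α HasExponents map W (unions (Z α))
  coeff-Fₐ = product-hasExponents (Z α)

  unions-Z-unique : ∀ {es} → es ∈ unions (Z α) → Unique es
  unions-Z-unique = All.lookup (unions-unique (Z α) orbits-unique orbits-disjoint)

  union⇒fixes : ∀ {es} G → es ∈ unions (Z α) → es IsEdgeListOf G → Fixes α G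
  union⇒fixes {es} G es∈ es~G = invariant⇒fixes α G λ e → T-⇔⇒≡ (mk⇔
    (λ Gαe → Equivalence.to es~G (unions-resp (Z α) reflects es∈ (Equivalence.from es~G Gαe)))
    (λ Ge  → Equivalence.to es~G (unions-resp (Z α) closed es∈ (Equivalence.from es~G Ge))))
    where
    closed : ∀ {e z} → z ∈ Z α → e ∈ z → (α ′) e ∈ z
    closed z∈ e∈z with _ , _ , refl ← ∈-map⁻ orbit z∈ = orbit-closed e∈z

    reflects : ∀ {e z} → z ∈ Z α → (α ′) e ∈ z → e ∈ z
    reflects z∈ e∈z with _ , _ , refl ← ∈-map⁻ orbit z∈ = orbit-reflects e∈z

  fixes⇒union : ∀ G → Fixes α G → ∃[ es ] (es ∈ unions (Z α) × es IsEdgeListOf G)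
  fixes⇒union G fixes =
    let es , es∈ , es~ = ∈-unions {P = T ∘ G} (Z α) (all-orbits Constant constant)
    in es , es∈ , λ {e} → mk⇔ (proj₂ ∘ Equivalence.to es~) (λ Ge → Equivalence.from es~ (orbits-cover e , Ge))
    where
    orbit-constant : ∀ {e f} → f ∈ orbit e → G f ≡ G e
    orbit-constant = orbit-invariant G (fixes⇒invariant α G fixes)

    Constant : List (Pair n) → Set
    Constant z = (∀ {f} → f ∈ z → T (G f)) ⊎ (∀ {f} → f ∈ z → ¬ T (G f))

    constant : ∀ e → Constant (orbit e)
    constant e with Bool.T? (G e)
    ... | yes Ge = inj₁ λ f∈ → subst T (sym (orbit-constant f∈)) Ge
    ... | no ¬Ge = inj₂ λ f∈ Gf → ¬Ge (subst T (orbit-constant f∈) Gf)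

  coeff-Fₐ-fixes : ∀ G → Fixes α G → coeff (Fₐ α) (label G) ≡ 1
  coeff-Fₐ-fixes G fixes = let es , es∈ , es~G = fixes⇒union G fixes in
    trans (coeff-Fₐ (label G)) (count-unique-∈ {label G} {map W (unions (Z α))}
      (W-unions-unique (Z α) orbits-unique orbits-disjoint orbits-nonempty)
      (subst (_∈ map W (unions (Z α))) (W-edgeList (unions-Z-unique es∈) es~G) (∈-map⁺ W es∈)))

  coeff-Fₐ-¬fixes : ∀ G → ¬ Fixes α G → coeff (Fₐ α) (label G) ≡ 0
  coeff-Fₐ-¬fixes G ¬fixes = trans (coeff-Fₐ (label G)) (count-∉ {label G} {map W (unions (Z α))} (¬∈ ∘ ∈-map⁻ W))
    where
    ¬∈ : ¬ (∃[ es ] (es ∈ unions (Z α) × label G ≡ W es))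
    ¬∈ (es , es∈ , eq) = ¬fixes (union⇒fixes G es∈ (W-injective (unions-Z-unique es∈) (sym eq)))

  coeff-Fₐ≢0⇒label : ∀ {L} → coeff (Fₐ α) L ≢ 0 → ∃[ G ] label G ≡ L
  coeff-Fₐ≢0⇒label {L} ≢0 =
    let es , es∈ , L≡ = ∈-map⁻ W (count≢0⇒∈ {L} {map W (unions (Z α))} (≢0 ∘ trans (coeff-Fₐ L)))
    in graph es , trans (sym (W-edgeList (unions-Z-unique es∈) (graph-edgeList es))) (sym L≡)

stabiliser : Graph n → List (Permutation′ n)
stabiliser {n} G = filter (fixes? G) (permutations n)

c-label : (G : Graph n) → c n (label G) ≡ length (stabiliser G)
c-label {n} G = go (permutations n)
  where
  go : ∀ αs → coeff (foldr _⊕_ [] (map Fₐ αs)) (label G) ≡ length (filter (fixes? G) αs)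
  go []       = refl
  go (α ∷ αs) = trans (coeff-⊕ (Fₐ α) _ (label G)) (step (fixes? G α))
    where
    step : Dec (Fixes α G) → coeff (Fₐ α) (label G) + coeff (foldr _⊕_ [] (map Fₐ αs)) (label G)
                             ≡ length (filter (fixes? G) (α ∷ αs))
    step (yes fixes) = trans (cong₂ _+_ (coeff-Fₐ-fixes α G fixes) (go αs))
                             (cong length (sym (filter-accept (fixes? G) fixes)))
    step (no ¬fixes) = trans (cong₂ _+_ (coeff-Fₐ-¬fixes α G ¬fixes) (go αs))
                             (cong length (sym (filter-reject (fixes? G) ¬fixes)))

c≢0⇒label : ∀ n {L} → c n L ≢ 0 → ∃[ G ] label {n} G ≡ L
c≢0⇒label n {L} = go (permutations n)
  where
  go : ∀ αs → coeff (foldr _⊕_ [] (map Fₐ αs)) L ≢ 0 → ∃[ G ] label {n} G ≡ L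
  go []       ≢0 = contradiction refl ≢0
  go (α ∷ αs) ≢0 = choose (coeff (Fₐ α) L ℕ.≟ 0)
    where
    choose : Dec (coeff (Fₐ α) L ≡ 0) → ∃[ G ] label {n} G ≡ L
    choose (no  Fₐ≢0) = coeff-Fₐ≢0⇒label α Fₐ≢0
    choose (yes Fₐ≡0) = go αs λ F≡0 → ≢0 (trans (coeff-⊕ (Fₐ α) _ L) (cong₂ _+_ Fₐ≡0 F≡0))

-- The bijection between graphs and exponents

Γ-hasCardinality : (G : Graph n) → Γ G HasCardinality c n (label G)
Γ-hasCardinality {n} G = subst (Γ G HasCardinality_) (sym (c-label G))
  (enumeration⇒hasCardinality (Sym n)
    (AllPairs.filter⁺ (fixes? G) (permutations-unique n))
    (All.all-filter (fixes? G) (permutations n))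
    (λ {α} fixes → SetoidMembershipProperties.∈-filter⁺ (Sym n) {P = λ α → Fixes α G} (fixes? G)
      (λ {α} {β} → fixes-cong G {α} {β}) {α} {permutations n} (∈-permutations α) fixes))

𝓛-hasCardinality : ∀ n {ξ} → ξ ≢ 0 → ∃[ k ] 𝓛 n ξ HasCardinality k
𝓛-hasCardinality n {ξ} ξ≢0 = _ , enumeration⇒hasCardinality (setoid ℕ)
  (Unique.filter⁺ (λ L → c n L ℕ.≟ ξ) (Unique.upTo⁺ (length (F n))))
  (All.all-filter (λ L → c n L ℕ.≟ ξ) (upTo (length (F n))))
  (λ c≡ξ → ∈-filter⁺ (λ L → c n L ℕ.≟ ξ)
    (∈-upTo⁺ (coeff≢0⇒<length (F n) (ξ≢0 ∘ trans (sym c≡ξ)))) c≡ξ)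

label-inverse : ∀ n {ξ} → ξ ≢ 0 → Inverse (GraphsWithAut n ξ) (𝓛 n ξ)
label-inverse n {ξ} ξ≢0 = record
  { to        = λ (G , Γ↔ξ) → label G , hasCardinality-unique (Γ-hasCardinality G) Γ↔ξ
  ; from      = λ (L , c≡ξ) → decode L c≡ξ , subst (Γ (decode L c≡ξ) HasCardinality_)
                    (trans (cong (c n) (label-decode L c≡ξ)) c≡ξ) (Γ-hasCardinality (decode L c≡ξ))
  ; to-cong   = label-cong
  -- The decoded graph may depend on the proof that the coefficient is `ξ`, but its label does not.
  ; from-cong = λ { {L , p} {_ , q} refl → label-injective _ _ (trans (label-decode L p) (sym (label-decode L q))) }
  ; inverse   = (λ { {L , c≡ξ} G≗ → trans (label-cong G≗) (label-decode L c≡ξ) })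
              , (λ { {G , _} {L , c≡ξ} refl → label-injective _ _ (label-decode L c≡ξ) })
  }
  where
  decode : ∀ L → c n L ≡ ξ → Graph n
  decode L c≡ξ = proj₁ (c≢0⇒label n (ξ≢0 ∘ trans (sym c≡ξ)))

  label-decode : ∀ L c≡ξ → label (decode L c≡ξ) ≡ L
  label-decode L c≡ξ = proj₂ (c≢0⇒label n (ξ≢0 ∘ trans (sym c≡ξ)))

theorem6 : (n : ℕ) → 3 ≤ n → (ξ : ℕ) → 𝓒 n ξ →
    ∃[ k ] (GraphsWithAut n ξ HasCardinality k × 𝓛 n ξ HasCardinality k)
theorem6 n _ ξ (L , c≢0 , c≡ξ) =
  let k , 𝓛↔k = 𝓛-hasCardinality n ξ≢0
  in  k , Composition.inverse (label-inverse n ξ≢0) 𝓛↔k , 𝓛↔k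
  where
  ξ≢0 : ξ ≢ 0
  ξ≢0 = c≢0 ∘ trans c≡ξ
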